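{- The extension of $\mathrm{UNFP}$ with non-monadic fixpoint operators has an undecidable satisfiability problem, both on arbitrary structures and on finite structures.
   Context: $\mathrm{UNFO}$ consists of the first-order formulas generated by $\phi ::= R(\bar x)\mid x=y\mid \phi\wedge\phi\mid\phi\vee\phi\mid\exists x\,\phi\mid\neg\phi$, where in the last clause $\phi$ has at most one free first-order variable. $\mathrm{UNFP}$ extends it with unary second-order variables and monadic least fixpoint formulas $[\mathrm{LFP}_{X,x}\,\phi(X,\bar X,x)](y)$ ($X$ unary, occurring only positively in $\phi$). The extension with non-monadic fixpoint operators additionally permits fixpoint variables $X$ of arbitrary arity $n$ and formulas $[\mathrm{LFP}_{X,\bar x}\,\phi(X,\bar x)](\bar y)$ with $\bar x,\bar y$ tuples of length $n$ and $X$ occurring only positively in $\phi$, with the usual least-fixpoint semantics, while negation is still only applied to formulas with at most one free first-order variable. -}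

module Defs where

import Level
open import Level using (Lift)
open import Data.Nat using (ℕ; zero; suc; _≡ᵇ_; _≟_)
open import Data.Bool using (Bool; true; false; not; if_then_else_; _∧_; _∨_)
open import Data.Fin using (Fin)
open import Data.Vec as Vec using (Vec; []; _∷_; toList)
open import Data.List as List using (List; []; _∷_; _++_; filterᵇ; concatMap; length; lookup)
open import Data.List.Relation.Unary.All using (All)
open import Data.List.Relation.Unary.Unique.Propositional using (Unique)
open import Data.List.Membership.Propositional using (_∈_)
open import Data.Product using (Σ; _×_; _,_; proj₁; proj₂; ∃)
open import Data.Sum using (_⊎_)
open import Data.Unit using (⊤)
open import Relation.Nullary using (¬_; Dec; yes; no)
open import Relation.Binary.PropositionalEquality using (_≡_; _≢_; refl)
open import Function using (_∘_)
open import Function.Bundles using (_↔_)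

Var : Set
Var = ℕ

data Formula : Set where
  rel  : (R : ℕ) (n : ℕ) → Vec Var n → Formula
  svar : (X : ℕ) (n : ℕ) → Vec Var n → Formula
  eq   : Var → Var → Formula
  and  : Formula → Formula → Formula
  or   : Formula → Formula → Formula
  ex   : Var → Formula → Formula
  neg  : Formula → Formula
  -- [LFP_{X,x̄} φ](ȳ), X of arity suc n, x̄ and ȳ of length suc n
  lfp  : (X : ℕ) (n : ℕ) → Vec Var (suc n) → Formula → Vec Var (suc n) → Formula

elem : Var → List Var → Bool
elem x []       = false
elem x (y ∷ ys) = (x ≡ᵇ y) ∨ elem x ys

removeAll : List Var → List Var → List Var
removeAll xs l = filterᵇ (λ v → not (elem v xs)) l

fv : Formula → List Var
fv (rel R n xs)       = toList xs
fv (svar X n xs)      = toList xs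
fv (eq x y)           = x ∷ y ∷ []
fv (and φ ψ)          = fv φ ++ fv ψ
fv (or φ ψ)           = fv φ ++ fv ψ
fv (ex x φ)           = removeAll (x ∷ []) (fv φ)
fv (neg φ)            = fv φ
fv (lfp X n xs φ ys)  = removeAll (toList xs) (fv φ) ++ toList ys

-- OnlyPol b X n φ : every free occurrence of the second-order variable
-- (X, arity n) in φ has polarity b (true = under an even number of negations).
OnlyPol : Bool → ℕ → ℕ → Formula → Set
OnlyPol b X n (rel R m xs)  = ⊤
OnlyPol b X n (svar Y m xs) = if (X ≡ᵇ Y) ∧ (n ≡ᵇ m) then b ≡ true else ⊤
OnlyPol b X n (eq x y)      = ⊤
OnlyPol b X n (and φ ψ)     = OnlyPol b X n φ × OnlyPol b X n ψ
OnlyPol b X n (or φ ψ)      = OnlyPol b X n φ × OnlyPol b X n ψ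
OnlyPol b X n (ex x φ)      = OnlyPol b X n φ
OnlyPol b X n (neg φ)       = OnlyPol (not b) X n φ
OnlyPol b X n (lfp Y m xs φ ys) =
  if (X ≡ᵇ Y) ∧ (n ≡ᵇ suc m) then ⊤ else OnlyPol b X n φ

AtMostOne : List Var → Set
AtMostOne l = ∃ λ v → All (_≡ v) l

WF : Formula → Set
WF (rel R n xs)      = ⊤
WF (svar X n xs)     = ⊤
WF (eq x y)          = ⊤
WF (and φ ψ)         = WF φ × WF ψ
WF (or φ ψ)          = WF φ × WF ψ
WF (ex x φ)          = WF φ
WF (neg φ)           = WF φ × AtMostOne (fv φ)
WF (lfp X n xs φ ys) =
  WF φ × Unique (toList xs) × All (_∈ toList xs) (fv φ) × OnlyPol true X (suc n) φ

record Structure : Set₁ where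
  field
    D   : Set
    elt : D
    R   : ℕ → (n : ℕ) → Vec D n → Set

module Sem (A : Structure) where
  open Structure A

  FOVal : Set
  FOVal = Var → D

  SOVal : Set₁
  SOVal = ℕ → (n : ℕ) → Vec D n → Set

  update : FOVal → Var → D → FOVal
  update g x d y = if x ≡ᵇ y then d else g y

  updates : ∀ {k} → FOVal → Vec Var k → Vec D k → FOVal
  updates g []       []       = g
  updates g (x ∷ xs) (d ∷ ds) = updates (update g x d) xs ds

  supdate : SOVal → ℕ → (n : ℕ) → (Vec D n → Set) → SOVal
  supdate s X n P Y m with X ≡ᵇ Y | n ≟ m
  ... | true | yes refl = P
  ... | _    | _        = s Y m

  ⟦_⟧ : Formula → FOVal → SOVal → Set₁
  ⟦ rel r n xs ⟧ g s  = Lift (Level.suc Level.zero) (R r n (Vec.map g xs))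
  ⟦ svar X n xs ⟧ g s = Lift (Level.suc Level.zero) (s X n (Vec.map g xs))
  ⟦ eq x y ⟧ g s      = Lift (Level.suc Level.zero) (g x ≡ g y)
  ⟦ and φ ψ ⟧ g s     = ⟦ φ ⟧ g s × ⟦ ψ ⟧ g s
  ⟦ or φ ψ ⟧ g s      = ⟦ φ ⟧ g s ⊎ ⟦ ψ ⟧ g s
  ⟦ ex x φ ⟧ g s      = Σ D λ d → ⟦ φ ⟧ (update g x d) s
  ⟦ neg φ ⟧ g s       = ¬ ⟦ φ ⟧ g s
  -- least fixpoint = intersection of all prefixed points (Knaster–Tarski)
  ⟦ lfp X n xs φ ys ⟧ g s =
    (P : Vec D (suc n) → Set) →
    ((ds : Vec D (suc n)) → ⟦ φ ⟧ (updates g xs ds) (supdate s X (suc n) P) → Lift (Level.suc Level.zero) (P ds)) →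
    Lift (Level.suc Level.zero) (P (Vec.map g ys))

Sat : Formula → Set₁
Sat φ = Σ Structure λ A → let open Sem A in
  Σ FOVal λ g → Σ SOVal λ s → ⟦ φ ⟧ g s

FinSat : Formula → Set₁
FinSat φ = Σ Structure λ A → let open Sem A in
  Σ ℕ (λ k → Structure.D A ↔ Fin k) × (Σ FOVal λ g → Σ SOVal λ s → ⟦ φ ⟧ g s)

PCP : Set
PCP = List (List Bool × List Bool)

Solvable : PCP → Set
Solvable P = Σ (List (Fin (length P))) λ is →
  is ≢ [] × concatMap (proj₁ ∘ lookup P) is ≡ concatMap (proj₂ ∘ lookup P) is

-- Synthetic undecidability: a decision procedure for the problem would
-- yield a decision procedure for PCP.
SatDecidable : Set₁
SatDecidable = (φ : Formula) → WF φ → Dec (Sat φ)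

FinSatDecidable : Set₁
FinSatDecidable = (φ : Formula) → WF φ → Dec (FinSat φ)

PCPDecidable : Set
PCPDecidable = (P : PCP) → Dec (Solvable P)

-- Reduction from Post's correspondence problem.  In a structure with roots,
-- edges and nodes labelled by letters, a binary least fixpoint collects the
-- pairs of nodes reached from roots by reading the top and the bottom word of
-- one and the same sequence of tiles.  Two further binary fixpoints, "strictly
-- shallower than" and "as deep as" (depth measured from the roots), are used
-- in negated sentences to force every node to have a unique depth and all
-- nodes of equal depth to carry the same letter.  Then two words read from
-- roots to a common node coincide, so a node reached by both words of a
-- nonempty tile sequence yields a solution.  Conversely the solution word,
-- written along a finite path, is a model.
module Submission where

import Level
open import Level using (Lift; lift; lower)
open import Data.Bool using (Bool; true; false; not; T)
open import Data.Empty using (⊥; ⊥-elim)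
open import Data.Fin as Fin using (Fin; toℕ)
open import Data.List
  using (List; []; _∷_; _++_; _∷ʳ_; [_]; concatMap; length; lookup; drop; filterᵇ; initLast; _∷ʳ′_)
open import Data.List.Properties using (++-identityʳ; length-++; concatMap-++; ∷ʳ-++)
open import Data.List.Relation.Unary.All as All using (All; []; _∷_)
open import Data.List.Relation.Unary.All.Properties using (filter⁺; all-filter; ++⁺)
open import Data.List.Relation.Unary.Any using (here; there)
open import Data.List.Relation.Unary.AllPairs using ([]; _∷_)
open import Data.List.Membership.Propositional using (_∈_)
open import Data.List.Relation.Unary.Unique.Propositional using (Unique)
open import Data.Nat using (ℕ; zero; suc; _+_; _<_; _≤_; _≡ᵇ_; _≟_; z≤n; s≤s; s≤s⁻¹; z<s; s<s)
open import Data.Nat.Properties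
  using (≡⇒≡ᵇ; ≡ᵇ⇒≡; ≤∧≢⇒<; >⇒≢; <⇒≤; <-cmp; <-irrefl; n<1+n; m<n⇒m<1+n;
         +-suc; +-identityʳ; suc-injective)
open import Data.Product using (∃; _×_; _,_; proj₁; proj₂)
open import Data.Sum using (inj₁; inj₂)
open import Data.Unit using (tt)
open import Data.Vec using (Vec; []; _∷_; toList)
open import Function using (_∘_)
open import Function.Properties.Inverse using (↔-refl)
open import Relation.Binary.Definitions using (tri<; tri≈; tri>)
open import Relation.Binary.PropositionalEquality
  using (_≡_; _≢_; refl; sym; trans; cong; cong₂; subst; subst₂)
open import Relation.Nullary using (Dec)
open import Relation.Nullary.Decidable using (True; toWitness; T?; map′)
open import Data.List.Membership.DecPropositional _≟_ using (_∈?_)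

open import Defs

Lift₁ : Set → Set₁
Lift₁ = Lift (Level.suc Level.zero)

top bottom : (P : PCP) → Fin (length P) → List Bool
top    P = proj₁ ∘ lookup P
bottom P = proj₂ ∘ lookup P

topWord bottomWord : (P : PCP) → List (Fin (length P)) → List Bool
topWord    P = concatMap (top P)
bottomWord P = concatMap (bottom P)

concatMap-∷ʳ : ∀ {A B : Set} (f : A → List B) xs x → concatMap f (xs ∷ʳ x) ≡ concatMap f xs ++ f x
concatMap-∷ʳ f xs x = trans (concatMap-++ f xs [ x ]) (cong (concatMap f xs ++_) (++-identityʳ (f x)))

-- Relation symbols: 0 roots, 1 edges, 2 and 3 the letters false and true.
letter : Bool → ℕ
letter false = 2
letter true  = 3

isRoot : Var → Formula
isRoot x = rel 0 1 (x ∷ [])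

edge : Var → Var → Formula
edge x y = rel 1 2 (x ∷ y ∷ [])

falsum : Formula
falsum = neg (eq 0 0)

-- The intermediate nodes are bound to the variables k, k + 1, …
readWord : List Bool → Var → Var → Var → Formula
readWord []      a b k = eq a b
readWord (c ∷ w) a b k = ex k (and (edge a k) (and (rel (letter c) 1 (k ∷ [])) (readWord w k b (suc k))))

someTile : PCP → Var → Var → Var → Var → Formula
someTile []            a b x y = falsum
someTile ((u , v) ∷ P) a b x y = or (and (readWord u a x 4) (readWord v b y 4)) (someTile P a b x y)

0<4 : 0 < 4
0<4 = z<s

1<4 : 1 < 4
1<4 = s<s z<s

2<4 : 2 < 4
2<4 = s<s (s<s z<s)

3<4 : 3 < 4
3<4 = s<s (s<s (s<s z<s))

pairVars : Vec Var 2
pairVars = 0 ∷ 1 ∷ []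

lfpPair : Formula → Var → Var → Formula
lfpPair φ x y = lfp 0 1 pairVars φ (x ∷ y ∷ [])

recur : Var → Var → Formula
recur x y = svar 0 2 (x ∷ y ∷ [])

reachedBody : PCP → Formula
reachedBody P = or (and (isRoot 0) (isRoot 1)) (ex 2 (ex 3 (and (recur 2 3) (someTile P 2 3 0 1))))

shallowerBody : Formula
shallowerBody =
  or (and (isRoot 0) (ex 2 (and (edge 2 1) (isRoot 2))))
     (or (ex 2 (ex 3 (and (edge 2 0) (and (edge 3 1) (recur 2 3)))))
         (ex 3 (and (edge 3 1) (recur 0 3))))

sameDepthBody : Formula
sameDepthBody = or (and (isRoot 0) (isRoot 1)) (ex 2 (ex 3 (and (edge 2 0) (and (edge 3 1) (recur 2 3)))))

depthsUnique : Formula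
depthsUnique = neg (ex 0 (lfpPair shallowerBody 0 0))

lettersByDepth : Formula
lettersByDepth =
  neg (ex 0 (ex 1 (and (lfpPair sameDepthBody 0 1)
                       (and (rel (letter false) 1 (0 ∷ [])) (rel (letter true) 1 (1 ∷ []))))))

solutionEnd : PCP → Formula
solutionEnd P = ex 0 (ex 2 (ex 3 (and (lfpPair (reachedBody P) 2 3) (someTile P 2 3 0 0))))

pcpFormula : PCP → Formula
pcpFormula P = and depthsUnique (and lettersByDepth (solutionEnd P))

FreeBelow : ℕ → Formula → Set
FreeBelow n φ = All (_< n) (fv φ)

removed-≢ : ∀ {v k} → T (not (elem v (k ∷ []))) → v ≢ k
removed-≢ {v} notElem refl with v ≡ᵇ v | ≡⇒≡ᵇ v v refl
... | true | _ = notElem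

All-filterᵇ : ∀ {P Q : ℕ → Set} (f : ℕ → Bool) {l} →
              All P l → (∀ {v} → P v → T (f v) → Q v) → All Q (filterᵇ f l)
All-filterᵇ f {l} Pl PQ =
  All.zipWith (λ (Pv , fv) → PQ Pv fv) (filter⁺ (T? ∘ f) Pl , all-filter (T? ∘ f) l)

removeAll-below : ∀ {k l} → All (_< suc k) l → All (_< k) (removeAll (k ∷ []) l)
removeAll-below below =
  All-filterᵇ _ below (λ v<1+k notElem → ≤∧≢⇒< (s≤s⁻¹ v<1+k) (removed-≢ notElem))

readWord-freeBelow : ∀ w {a b k} → a < k → b < k → FreeBelow k (readWord w a b k)
readWord-freeBelow []      a<k b<k = a<k ∷ b<k ∷ []
readWord-freeBelow (c ∷ w) {k = k} a<k b<k =
  removeAll-below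
    (m<n⇒m<1+n a<k ∷ n<1+n k ∷ n<1+n k ∷ readWord-freeBelow w (n<1+n k) (m<n⇒m<1+n b<k))

someTile-freeBelow : ∀ P {a b x y} → a < 4 → b < 4 → x < 4 → y < 4 →
                     FreeBelow 4 (someTile P a b x y)
someTile-freeBelow []            _   _   _   _   = z<s ∷ z<s ∷ []
someTile-freeBelow ((u , v) ∷ P) a<4 b<4 x<4 y<4 =
  ++⁺ (++⁺ (readWord-freeBelow u a<4 x<4) (readWord-freeBelow v b<4 y<4))
      (someTile-freeBelow P a<4 b<4 x<4 y<4)

below-two : ∀ {v} → v < 2 → v ∈ toList pairVars
below-two z<s             = here refl
below-two (s<s z<s)       = there (here refl)

reachedBody-bound : ∀ P → All (_∈ toList pairVars) (fv (reachedBody P))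
reachedBody-bound P =
  All.map below-two
    (z<s ∷ s<s z<s ∷
     removeAll-below (removeAll-below (2<4 ∷ 3<4 ∷ someTile-freeBelow P 2<4 3<4 0<4 1<4)))

boundBy-pairVars : (φ : Formula) → {True (All.all? (_∈? toList pairVars) (fv φ))} →
                   All (_∈ toList pairVars) (fv φ)
boundBy-pairVars φ {bound} = toWitness bound

pairVars-unique : Unique (toList pairVars)
pairVars-unique = ((λ ()) ∷ []) ∷ [] ∷ []

readWord-wf : ∀ w {a b k} → WF (readWord w a b k)
readWord-wf []      = tt
readWord-wf (c ∷ w) = tt , tt , readWord-wf w

readWord-onlyPol : ∀ pol X n w {a b k} → OnlyPol pol X n (readWord w a b k)
readWord-onlyPol pol X n []      = tt
readWord-onlyPol pol X n (c ∷ w) = tt , tt , readWord-onlyPol pol X n w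

someTile-wf : ∀ P {a b x y} → WF (someTile P a b x y)
someTile-wf []            = tt , (0 , refl ∷ refl ∷ [])
someTile-wf ((u , v) ∷ P) = (readWord-wf u , readWord-wf v) , someTile-wf P

someTile-onlyPol : ∀ pol X n P {a b x y} → OnlyPol pol X n (someTile P a b x y)
someTile-onlyPol pol X n []            = tt
someTile-onlyPol pol X n ((u , v) ∷ P) =
  (readWord-onlyPol pol X n u , readWord-onlyPol pol X n v) , someTile-onlyPol pol X n P

depthsUnique-wf : WF depthsUnique
depthsUnique-wf =
  (((tt , tt , tt) , (tt , tt , tt) , (tt , tt)) , pairVars-unique , boundBy-pairVars shallowerBody ,
   (tt , tt , tt) , ((tt , tt , refl) , (tt , refl))) , (0 , [])

lettersByDepth-wf : WF lettersByDepth
lettersByDepth-wf =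
  ((((tt , tt) , (tt , tt , tt)) , pairVars-unique , boundBy-pairVars sameDepthBody ,
    (tt , tt) , (tt , tt , refl)) , (tt , tt)) , (0 , [])

solutionEnd-wf : ∀ P → WF (solutionEnd P)
solutionEnd-wf P =
  (((tt , tt) , tt , someTile-wf P) , pairVars-unique , reachedBody-bound P ,
   (tt , tt) , (refl , someTile-onlyPol true 0 2 P)) , someTile-wf P

pcpFormula-wf : ∀ P → WF (pcpFormula P)
pcpFormula-wf P = depthsUnique-wf , lettersByDepth-wf , solutionEnd-wf P

-- Models of the sentence encode solutions

module Semantics (A : Structure) where
  open Structure A
  open Sem A

  Root : D → Set
  Root x = R 0 1 (x ∷ [])

  Edge : D → D → Set
  Edge x y = R 1 2 (x ∷ y ∷ [])

  Letter : Bool → D → Set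
  Letter c x = R (letter c) 1 (x ∷ [])

  Walk : List Bool → D → D → Set
  Walk []      p q = p ≡ q
  Walk (c ∷ w) p q = ∃ λ z → Edge p z × Letter c z × Walk w z q

  walk-++ : ∀ u {w p q r} → Walk u p q → Walk w q r → Walk (u ++ w) p r
  walk-++ []      refl         wq = wq
  walk-++ (c ∷ u) (z , e , l , wu) wq = z , e , l , walk-++ u wu wq

  update-same : ∀ g x d → update g x d x ≡ d
  update-same g x d with x ≡ᵇ x | ≡⇒≡ᵇ x x refl
  ... | true | _ = refl

  update-≢ : ∀ g {x y} d → x ≢ y → update g x d y ≡ g y
  update-≢ g {x} {y} d x≢y with x ≡ᵇ y in x≡ᵇy
  ... | true  = ⊥-elim (x≢y (≡ᵇ⇒≡ x y (subst T (sym x≡ᵇy) tt)))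
  ... | false = refl

  update-below : ∀ g {k a} d → a < k → update g k d a ≡ g a
  update-below g d a<k = update-≢ g d (>⇒≢ a<k)

  readWord-sound : ∀ w {a b k g s} → a < k → b < k → ⟦ readWord w a b k ⟧ g s → Walk w (g a) (g b)
  readWord-sound []      _   _   (lift a≡b) = a≡b
  readWord-sound (c ∷ w) {a} {b} {k} {g} a<k b<k (d , lift e , lift l , r) =
    d , subst₂ Edge (update-below g d a<k) (update-same g k d) e , subst (Letter c) (update-same g k d) l ,
    subst₂ (Walk w) (update-same g k d) (update-below g d b<k)
      (readWord-sound w (n<1+n k) (m<n⇒m<1+n b<k) r)

  readWord-complete : ∀ w {a b k g s} → a < k → b < k → Walk w (g a) (g b) → ⟦ readWord w a b k ⟧ g s
  readWord-complete []      _   _   a≡b = lift a≡b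
  readWord-complete (c ∷ w) {a} {b} {k} {g} a<k b<k (d , e , l , r) =
    d , lift (subst₂ Edge (sym (update-below g d a<k)) (sym (update-same g k d)) e) ,
    lift (subst (Letter c) (sym (update-same g k d)) l) ,
    readWord-complete w (n<1+n k) (m<n⇒m<1+n b<k)
      (subst₂ (Walk w) (sym (update-same g k d)) (sym (update-below g d b<k)) r)

  TileStep : PCP → D → D → D → D → Set
  TileStep P a b x y = ∃ λ i → Walk (top P i) a x × Walk (bottom P i) b y

  someTile-sound : ∀ P {a b x y g s} → a < 4 → b < 4 → x < 4 → y < 4 →
                   ⟦ someTile P a b x y ⟧ g s → TileStep P (g a) (g b) (g x) (g y)
  someTile-sound []            _   _   _   _   ff = ⊥-elim (ff (lift refl))
  someTile-sound ((u , v) ∷ P) a<4 b<4 x<4 y<4 (inj₁ (ru , rv)) =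
    Fin.zero , readWord-sound u a<4 x<4 ru , readWord-sound v b<4 y<4 rv
  someTile-sound ((u , v) ∷ P) a<4 b<4 x<4 y<4 (inj₂ t) with someTile-sound P a<4 b<4 x<4 y<4 t
  ... | i , wu , wv = Fin.suc i , wu , wv

  someTile-complete : ∀ P {a b x y g s} → a < 4 → b < 4 → x < 4 → y < 4 →
                      TileStep P (g a) (g b) (g x) (g y) → ⟦ someTile P a b x y ⟧ g s
  someTile-complete ((u , v) ∷ P) a<4 b<4 x<4 y<4 (Fin.zero , wu , wv) =
    inj₁ (readWord-complete u a<4 x<4 wu , readWord-complete v b<4 y<4 wv)
  someTile-complete ((u , v) ∷ P) a<4 b<4 x<4 y<4 (Fin.suc i , wu , wv) =
    inj₂ (someTile-complete P a<4 b<4 x<4 y<4 (i , wu , wv))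

  data AtDepth : D → ℕ → Set where
    root : ∀ {x} → Root x → AtDepth x 0
    step : ∀ {x y n} → AtDepth x n → Edge x y → AtDepth y (suc n)

  walk-depth : ∀ w {p q m} → AtDepth p m → Walk w p q → AtDepth q (m + length w)
  walk-depth []      {m = m} dp refl rewrite +-identityʳ m = dp
  walk-depth (c ∷ w) {m = m} dp (z , e , _ , wz) rewrite +-suc m (length w) = walk-depth w (step dp e) wz

  Prefixed : Formula → FOVal → SOVal → (Vec D 2 → Set) → Set₁
  Prefixed φ g s Q = (ds : Vec D 2) → ⟦ φ ⟧ (updates g pairVars ds) (supdate s 0 2 Q) → Lift₁ (Q ds)

  sameDepth-least : ∀ g s {Q p q n} → Prefixed sameDepthBody g s Q →
                    AtDepth p n → AtDepth q n → Lift₁ (Q (p ∷ q ∷ []))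
  sameDepth-least g s {Q} pre = go
    where
    go : ∀ {p q n} → AtDepth p n → AtDepth q n → Lift₁ (Q (p ∷ q ∷ []))
    go {p} {q} (root rp) (root rq) = pre (p ∷ q ∷ []) (inj₁ (lift rp , lift rq))
    go {p} {q} (step {x} dx e₁) (step {y} dy e₂) =
      pre (p ∷ q ∷ []) (inj₂ (x , y , lift e₁ , lift e₂ , go dx dy))

  shallower-least : ∀ g s {Q x y m n} → Prefixed shallowerBody g s Q →
                    AtDepth x m → AtDepth y n → m < n → Lift₁ (Q (x ∷ y ∷ []))
  shallower-least g s {Q} pre = go
    where
    below-root : ∀ {x y n} → Root x → AtDepth y (suc n) → Lift₁ (Q (x ∷ y ∷ []))
    below-root {x} {y} rx (step {z} (root rz) e) =
      pre (x ∷ y ∷ []) (inj₁ (lift rx , z , lift e , lift rz))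
    below-root {x} {y} rx (step {z} dz@(step _ _) e) =
      pre (x ∷ y ∷ []) (inj₂ (inj₂ (z , lift e , below-root rx dz)))

    go : ∀ {x y m n} → AtDepth x m → AtDepth y n → m < n → Lift₁ (Q (x ∷ y ∷ []))
    go (root rx) dy@(step _ _) _ = below-root rx dy
    go {x} {y} (step {x'} dx e₁) (step {y'} dy e₂) (s<s m<n) =
      pre (x ∷ y ∷ []) (inj₂ (inj₁ (x' , y' , lift e₁ , lift e₂ , go dx dy m<n)))

  DepthsUnique : Set
  DepthsUnique = ∀ {x m n} → AtDepth x m → AtDepth x n → m ≡ n

  LettersByDepth : Set
  LettersByDepth = ∀ {p q n} c c' → AtDepth p n → AtDepth q n → Letter c p → Letter c' q → c ≡ c'

  depthsUnique-sound : ∀ g s → ⟦ depthsUnique ⟧ g s → DepthsUnique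
  depthsUnique-sound g s unique {x} {m} {n} dm dn with <-cmp m n
  ... | tri< m<n _ _ = ⊥-elim (unique (x , λ Q pre → shallower-least (update g 0 x) s pre dm dn m<n))
  ... | tri≈ _ m≡n _ = m≡n
  ... | tri> _ _ n<m = ⊥-elim (unique (x , λ Q pre → shallower-least (update g 0 x) s pre dn dm n<m))

  lettersByDepth-sound : ∀ g s → ⟦ lettersByDepth ⟧ g s → LettersByDepth
  lettersByDepth-sound g s letters false false _ _ _ _ = refl
  lettersByDepth-sound g s letters true  true  _ _ _ _ = refl
  lettersByDepth-sound g s letters {p} {q} false true dp dq lp lq =
    ⊥-elim (letters (p , q , (λ Q pre → sameDepth-least (update (update g 0 p) 1 q) s pre dp dq) ,
                     lift lp , lift lq))
  lettersByDepth-sound g s letters {p} {q} true false dp dq lp lq =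
    ⊥-elim (letters (q , p , (λ Q pre → sameDepth-least (update (update g 0 q) 1 p) s pre dq dp) ,
                     lift lq , lift lp))

  word-by-depth : ∀ {p q x y n} u v → LettersByDepth → AtDepth p n → AtDepth q n →
                  Walk u p x → Walk v q y → length u ≡ length v → u ≡ v
  word-by-depth []      []       _       _  _  _                  _                  _ = refl
  word-by-depth (c ∷ u) (c' ∷ v) letters dp dq (z , e , l , wu) (z' , e' , l' , wv) |u|≡|v| =
    cong₂ _∷_ (letters c c' (step dp e) (step dq e') l l')
              (word-by-depth u v letters (step dp e) (step dq e') wu wv (suc-injective |u|≡|v|))

  RootedWalk : List Bool → D → Set
  RootedWalk w x = ∃ λ r → Root r × Walk w r x

  rooted-words-agree : ∀ {x} u v → DepthsUnique → LettersByDepth →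
                       RootedWalk u x → RootedWalk v x → u ≡ v
  rooted-words-agree u v unique letters (p , rp , wu) (q , rq , wv) =
    word-by-depth u v letters (root rp) (root rq) wu wv
      (unique (walk-depth u (root rp) wu) (walk-depth v (root rq) wv))

  rootedWalk-snoc : ∀ {B : Set} (f : B → List Bool) bs b {a x} →
                    RootedWalk (concatMap f bs) a → Walk (f b) a x → RootedWalk (concatMap f (bs ∷ʳ b)) x
  rootedWalk-snoc f bs b {x = x} (r , rr , wa) wb =
    r , rr , subst (λ w → Walk w r x) (sym (concatMap-∷ʳ f bs b)) (walk-++ (concatMap f bs) wa wb)

  Reached : PCP → Vec D 2 → Set
  Reached P (x ∷ y ∷ []) = ∃ λ is → RootedWalk (topWord P is) x × RootedWalk (bottomWord P is) y

  reached-prefixed : ∀ P {g s} → Prefixed (reachedBody P) g s (Reached P)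
  reached-prefixed P (x ∷ y ∷ []) (inj₁ (lift rx , lift ry)) =
    lift ([] , (x , rx , refl) , (y , ry , refl))
  reached-prefixed P (x ∷ y ∷ []) (inj₂ (a , b , lift (is , ta , bb) , t))
    with someTile-sound P 2<4 3<4 0<4 1<4 t
  ... | i , wt , wb =
    lift (is ∷ʳ i , rootedWalk-snoc (top P) is i ta wt , rootedWalk-snoc (bottom P) is i bb wb)

  solvable-from-model : ∀ P {g s} → ⟦ pcpFormula P ⟧ g s → Solvable P
  solvable-from-model P {g} {s} (unique , letters , x , a , b , reach , last)
    with reach (Reached P) (reached-prefixed P) | someTile-sound P 2<4 3<4 0<4 0<4 last
  ... | lift (is , ta , bb) | i , wt , wb =
    is ∷ʳ i , ∷ʳ-≢-[] is ,
    rooted-words-agree (topWord P (is ∷ʳ i)) (bottomWord P (is ∷ʳ i))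
      (depthsUnique-sound g s unique) (lettersByDepth-sound g s letters)
      (rootedWalk-snoc (top P) is i ta wt) (rootedWalk-snoc (bottom P) is i bb wb)
    where
    ∷ʳ-≢-[] : ∀ {B : Set} (bs : List B) {b} → bs ∷ʳ b ≢ []
    ∷ʳ-≢-[] []      ()
    ∷ʳ-≢-[] (_ ∷ _) ()

-- A solution yields a finite model

clamp : (N m : ℕ) → Fin (suc N)
clamp zero    m       = Fin.zero
clamp (suc N) zero    = Fin.zero
clamp (suc N) (suc m) = Fin.suc (clamp N m)

toℕ-clamp : ∀ {N m} → m ≤ N → toℕ (clamp N m) ≡ m
toℕ-clamp {zero}  z≤n       = refl
toℕ-clamp {suc N} z≤n       = refl
toℕ-clamp {suc N} (s≤s m≤N) = cong suc (toℕ-clamp m≤N)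

-- Node m + 1 of the path carries the m-th letter; the letter of the root is never read.
letterAt : List Bool → ℕ → Bool
letterAt W       zero          = false
letterAt []      (suc m)       = false
letterAt (c ∷ W) (suc zero)    = c
letterAt (c ∷ W) (suc (suc m)) = letterAt W (suc m)

drop-∷ : ∀ W m {c t} → drop m W ≡ c ∷ t → m < length W × letterAt W (suc m) ≡ c × drop (suc m) W ≡ t
drop-∷ (x ∷ W) zero    refl = z<s , refl , refl
drop-∷ (x ∷ W) (suc m) e with drop-∷ W m e
... | m<|W| , letterAt-m , e' = s<s m<|W| , letterAt-m , e'

drop-length-++ : ∀ {B : Set} (xs ys : List B) → drop (length xs) (xs ++ ys) ≡ ys
drop-length-++ []       ys = refl
drop-length-++ (x ∷ xs) ys = drop-length-++ xs ys

pathRel : (W : List Bool) → ℕ → (n : ℕ) → Vec (Fin (suc (length W))) n → Set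
pathRel W 0 1 (x ∷ [])     = toℕ x ≡ 0
pathRel W 1 2 (x ∷ y ∷ []) = toℕ y ≡ suc (toℕ x)
pathRel W 2 1 (x ∷ [])     = letterAt W (toℕ x) ≡ false
pathRel W 3 1 (x ∷ [])     = letterAt W (toℕ x) ≡ true
pathRel W _ _ _            = ⊥

pathModel : List Bool → Structure
pathModel W = record { D = Fin (suc (length W)) ; elt = Fin.zero ; R = pathRel W }

module PathModel (W : List Bool) where
  open Sem (pathModel W)
  open Semantics (pathModel W)

  Node : Set
  Node = Fin (suc (length W))

  node : ℕ → Node
  node = clamp (length W)

  letter-at : ∀ c x → letterAt W (toℕ x) ≡ c → Letter c x
  letter-at false x l = l
  letter-at true  x l = l

  path-walk : ∀ m w {rest} → drop m W ≡ w ++ rest → Walk w (node m) (node (m + length w))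
  path-walk m []      _ = cong node (sym (+-identityʳ m))
  path-walk m (c ∷ w) e with drop-∷ W m e
  ... | m<|W| , letterAt-m , e' =
    node (suc m) , trans (toℕ-clamp m<|W|) (cong suc (sym (toℕ-clamp (<⇒≤ m<|W|)))) ,
    letter-at c (node (suc m)) (trans (cong (letterAt W) (toℕ-clamp m<|W|)) letterAt-m) ,
    subst (λ n → Walk w (node (suc m)) (node n)) (sym (+-suc m (length w))) (path-walk (suc m) w e')

  infix-walk : ∀ pre w rest → pre ++ w ++ rest ≡ W → Walk w (node (length pre)) (node (length (pre ++ w)))
  infix-walk pre w rest e =
    subst (λ n → Walk w (node (length pre)) (node n)) (sym (length-++ pre))
      (path-walk (length pre) w (trans (cong (drop (length pre)) (sym e)) (drop-length-++ pre (w ++ rest))))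

  IndexBelow IndexEqual : Vec Node 2 → Set
  IndexBelow (x ∷ y ∷ []) = toℕ x < toℕ y
  IndexEqual (x ∷ y ∷ []) = toℕ x ≡ toℕ y

  shallower-prefixed : ∀ g s → Prefixed shallowerBody g s IndexBelow
  shallower-prefixed g s (x ∷ y ∷ []) (inj₁ (lift x-root , z , lift y-next , _))
    rewrite x-root | y-next = lift z<s
  shallower-prefixed g s (x ∷ y ∷ []) (inj₂ (inj₁ (x' , y' , lift x-next , lift y-next , lift x'<y')))
    rewrite x-next | y-next = lift (s<s x'<y')
  shallower-prefixed g s (x ∷ y ∷ []) (inj₂ (inj₂ (y' , lift y-next , lift x<y')))
    rewrite y-next = lift (m<n⇒m<1+n x<y')

  sameDepth-prefixed : ∀ g s → Prefixed sameDepthBody g s IndexEqual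
  sameDepth-prefixed g s (x ∷ y ∷ []) (inj₁ (lift x-root , lift y-root)) = lift (trans x-root (sym y-root))
  sameDepth-prefixed g s (x ∷ y ∷ []) (inj₂ (x' , y' , lift x-next , lift y-next , lift x'≡y')) =
    lift (trans x-next (trans (cong suc x'≡y') (sym y-next)))

  path-depthsUnique : ∀ g s → ⟦ depthsUnique ⟧ g s
  path-depthsUnique g s (x , least) =
    <-irrefl refl (lower (least IndexBelow (shallower-prefixed (update g 0 x) s)))

  path-lettersByDepth : ∀ g s → ⟦ lettersByDepth ⟧ g s
  path-lettersByDepth g s (x , y , least , lift x-false , lift y-true)
    with trans (sym x-false) (trans (cong (letterAt W) x≡y) y-true)
    where x≡y = lower (least IndexEqual (sameDepth-prefixed (update (update g 0 x) 1 y) s))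
  ... | ()

module SolutionModel (P : PCP) (js : List (Fin (length P))) (i : Fin (length P))
                     (solution : topWord P (js ∷ʳ i) ≡ bottomWord P (js ∷ʳ i)) where
  W : List Bool
  W = topWord P (js ∷ʳ i)

  open Sem (pathModel W)
  open Semantics (pathModel W)
  open PathModel W

  pos : (Fin (length P) → List Bool) → List (Fin (length P)) → Node
  pos f q = node (length (concatMap f q))

  tile-walk : ∀ f q k rest → concatMap f (q ++ k ∷ rest) ≡ W → Walk (f k) (pos f q) (pos f (q ∷ʳ k))
  tile-walk f q k rest e =
    subst (λ w → Walk (f k) (pos f q) (node (length w))) (sym (concatMap-∷ʳ f q k))
      (infix-walk (concatMap f q) (f k) (concatMap f rest) (trans (sym (concatMap-++ f q (k ∷ rest))) e))

  tile-step : ∀ q k rest → q ++ k ∷ rest ≡ js ∷ʳ i →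
              TileStep P (pos (top P) q) (pos (bottom P) q) (pos (top P) (q ∷ʳ k)) (pos (bottom P) (q ∷ʳ k))
  tile-step q k rest e =
    k , tile-walk (top P) q k rest (cong (topWord P) e)
      , tile-walk (bottom P) q k rest (trans (cong (bottomWord P) e) (sym solution))

  module PrefixedPoint {g s Q} (pre : Prefixed (reachedBody P) g s Q) where
    Reaches : List (Fin (length P)) → Set₁
    Reaches q = Lift₁ (Q (pos (top P) q ∷ pos (bottom P) q ∷ []))

    reaches-[] : Reaches []
    reaches-[] = pre _ (inj₁ (lift (toℕ-clamp z≤n) , lift (toℕ-clamp z≤n)))

    reaches-prefix : ∀ ks q {rest} → q ++ ks ++ rest ≡ js ∷ʳ i → Reaches q → Reaches (q ++ ks)
    reaches-prefix []       q _ r = subst Reaches (sym (++-identityʳ q)) r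
    reaches-prefix (k ∷ ks) q {rest} e r =
      subst Reaches (∷ʳ-++ q k ks)
        (reaches-prefix ks (q ∷ʳ k) (trans (∷ʳ-++ q k (ks ++ rest)) e)
          (pre _ (inj₂ (_ , _ , r , someTile-complete P 2<4 3<4 0<4 1<4 (tile-step q k (ks ++ rest) e)))))

  solutionEnd-holds : ∀ g s → ⟦ solutionEnd P ⟧ g s
  solutionEnd-holds g s =
    node (length W) , pos (top P) js , pos (bottom P) js ,
    (λ Q pre → PrefixedPoint.reaches-prefix pre js [] refl (PrefixedPoint.reaches-[] pre)) ,
    someTile-complete P 2<4 3<4 0<4 0<4
      (i , tile-walk (top P) js i [] refl ,
           subst (λ w → Walk (bottom P i) (pos (bottom P) js) (node (length w))) (sym solution)
             (tile-walk (bottom P) js i [] (sym solution)))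

  finSat : FinSat (pcpFormula P)
  finSat = pathModel W , (suc (length W) , ↔-refl) , g₀ , s₀ ,
           path-depthsUnique g₀ s₀ , path-lettersByDepth g₀ s₀ , solutionEnd-holds g₀ s₀
    where
    g₀ : FOVal
    g₀ _ = Fin.zero
    s₀ : SOVal
    s₀ _ _ _ = ⊥

solvable⇒finSat : ∀ P → Solvable P → FinSat (pcpFormula P)
solvable⇒finSat P (is , is≢[] , solution) with initLast is
... | []       = ⊥-elim (is≢[] refl)
... | js ∷ʳ′ i = SolutionModel.finSat P js i solution

finSat⇒sat : ∀ φ → FinSat φ → Sat φ
finSat⇒sat φ (A , _ , holds) = A , holds

sat⇒solvable : ∀ P → Sat (pcpFormula P) → Solvable P
sat⇒solvable P (A , g , s , holds) = Semantics.solvable-from-model A P holds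

decide-by-reduction : (S : Formula → Set₁) →
                      (∀ P → S (pcpFormula P) → Solvable P) → (∀ P → Solvable P → S (pcpFormula P)) →
                      ((φ : Formula) → WF φ → Dec (S φ)) → PCPDecidable
decide-by-reduction S sound complete decide P =
  map′ (sound P) (complete P) (decide (pcpFormula P) (pcpFormula-wf P))

theorem7p2 : (SatDecidable → PCPDecidable) × (FinSatDecidable → PCPDecidable)
theorem7p2 =
  decide-by-reduction Sat sat⇒solvable (λ P → finSat⇒sat (pcpFormula P) ∘ solvable⇒finSat P) ,
  decide-by-reduction FinSat (λ P → sat⇒solvable P ∘ finSat⇒sat (pcpFormula P)) solvable⇒finSat
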